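{- Let $\mathfrak M_i,\mathfrak N_i$ ($1\le i\le k$) be $\mathsf{FO(LFP^1)}$-Henkin structures over $\sigma$, the $\mathfrak M_i$ with pairwise disjoint domains and the $\mathfrak N_i$ with pairwise disjoint domains. For each $i$ let $\bar a_i,\bar b_i$ be non-empty sequences of first-order parameters $a_{i_1},\ldots,a_{i_m}$ in $\mathfrak M_i$ and $b_{i_1},\ldots,b_{i_m}$ in $\mathfrak N_i$, and $\bar A_i,\bar B_i$ sequences of set parameters $A_{i_1},\ldots,A_{i_{m'}}\in\mathbb A_{\mathfrak M_i}$, $B_{i_1},\ldots,B_{i_{m'}}\in\mathbb A_{\mathfrak N_i}$. If $(\mathfrak M_i,\bar A_i,\bar a_i)\equiv^n_{\mathsf{FO(LFP^1)}}(\mathfrak N_i,\bar B_i,\bar b_i)$ for all $1\le i\le k$, then $$\Big(\bigoplus^f_{1\le i\le k}\mathfrak M_i,(\bar A_1,\ldots,\bar A_k)^\cup,\bar a_1,\ldots,\bar a_k\Big)\equiv^n_{\mathsf{FO(LFP^1)}}\Big(\bigoplus^f_{1\le i\le k}\mathfrak N_i,(\bar B_1,\ldots,\bar B_k)^\cup,\bar b_1,\ldots,\bar b_k\Big).$$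
   Context: $\mathsf{FO(LFP^1)}$ extends first-order logic with set variables, atoms $Xy$ and formulas $[LFP_{Xx}\varphi]y$ ($\varphi$ positive in $X$); quantifier depth counts nested first-order quantifiers and $LFP$ operators. Henkin semantics: a frame is a relational structure $\mathfrak M$ with admissible sets $\mathbb A_{\mathfrak M}\subseteq\wp(dom(\mathfrak M))$; set variables take admissible values; $[LFP_{Xx}\varphi]y$ holds under $g$ iff $g(y)\in A$ for every $A\in\mathbb A_{\mathfrak M}$ such that every $a$ with $\mathfrak M,g[a/x,A/X]\models\varphi$ lies in $A$. An $\mathsf{FO(LFP^1)}$-Henkin structure is a frame in which every set $\{a:\mathfrak M,g[a/x]\models\varphi\}$ ($\varphi$ an $\mathsf{FO(LFP^1)}$-formula, $g$ an assignment) is admissible. A parametrized structure $(\mathfrak M,\bar A,\bar a)$ interprets extra unary predicates by $\bar A$ and constants by $\bar a$; $\equiv^n_{\mathsf{FO(LFP^1)}}$ means satisfying the same $\mathsf{FO(LFP^1)}$-formulas of quantifier depth at most $n$ with corresponding parameters. Fusion. $\sigma$ is purely relational, $\sigma^*=\sigma\cup\{Q_1,\ldots,Q_k\}$ with new unary $Q_i$, and $f$ maps each $n$-ary $P\in\sigma$ to a quantifier-free first-order $\sigma^*$-formula in $x_1,\ldots,x_n$. $\biguplus_i\mathfrak M_i$ is the $\sigma^*$-frame with domain $\bigcup_idom(\mathfrak M_i)$, $P\in\sigma$ interpreted as $\bigcup_iP^{\mathfrak M_i}$, $Q_i$ as $dom(\mathfrak M_i)$, admissible sets the sets $\bigcup_iA_i$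 with $A_i\in\mathbb A_{\mathfrak M_i}$. The $f$-fusion $\bigoplus^f_i\mathfrak M_i$ is the $\sigma$-frame with the same domain and admissible sets, each $P\in\sigma$ interpreted as the tuples satisfying $f(P)$ in $\biguplus_i\mathfrak M_i$. For a finite sequence of set parameters $A_1,\ldots,A_k$, $(A_1,\ldots,A_k)^\cup$ is the sequence of all unions $\bigcup_{i\in I}A_i$ for $I\subseteq\{1,\ldots,k\}$, ordered in a fixed canonical way depending on $I$ (the same on both sides). -}

module Defs where

open import Data.Nat using (ℕ; zero; suc; _⊔_; _≤_)
open import Data.Fin using (Fin; zero; suc)
open import Data.Vec using (Vec) renaming (map to vmap; lookup to vlookup)
open import Data.Vec.Functional using () renaming (_∷_ to _∷ᶠ_)
open import Data.Product using (Σ; _×_; _,_; proj₁; proj₂)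
open import Data.Sum using (_⊎_)
open import Data.Empty using (⊥; ⊥-elim)
open import Data.Bool using (Bool; true)
open import Relation.Binary.PropositionalEquality using (_≡_)
open import Relation.Nullary using (¬_)
open import Function.Bundles using (_⇔_)

record Sig : Set₁ where
  field
    Sym : Set
    ar  : Sym → ℕ
open Sig public

-- Syntax of FO(LFP^1) with parameters.
-- C : index set of constants (first-order parameters)
-- P : index set of extra unary predicates (set parameters)
-- n : number of first-order variables in scope (de Bruijn)
-- s : number of set variables in scope (de Bruijn)

data Term (C : Set) (n : ℕ) : Set where
  var : Fin n → Term C n
  con : C → Term C n

data Form (σ : Sig) (C P : Set) : ℕ → ℕ → Set where
  rel  : ∀ {n s} (R : Sym σ) → Vec (Term C n) (ar σ R) → Form σ C P n s
  eq   : ∀ {n s} → Term C n → Term C n → Form σ C P n s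
  par  : ∀ {n s} → P → Term C n → Form σ C P n s
  mem  : ∀ {n s} → Fin s → Term C n → Form σ C P n s
  neg  : ∀ {n s} → Form σ C P n s → Form σ C P n s
  and  : ∀ {n s} → Form σ C P n s → Form σ C P n s → Form σ C P n s
  or   : ∀ {n s} → Form σ C P n s → Form σ C P n s → Form σ C P n s
  ex   : ∀ {n s} → Form σ C P (suc n) s → Form σ C P n s
  all  : ∀ {n s} → Form σ C P (suc n) s → Form σ C P n s
  -- [LFP_{X x} φ] t : binds first-order variable 0 (x) and set variable 0 (X)
  lfp  : ∀ {n s} → Form σ C P (suc n) (suc s) → Term C n → Form σ C P n s

data Pos {σ : Sig} {C P : Set} : ∀ {n s} → Fin s → Form σ C P n s → Set
data Neg {σ : Sig} {C P : Set} : ∀ {n s} → Fin s → Form σ C P n s → Set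

data Pos {σ} {C} {P} where
  rel : ∀ {n s} {X : Fin s} R (ts : Vec (Term C n) (ar σ R)) → Pos X (rel {n = n} {s} R ts)
  eq  : ∀ {n s} {X : Fin s} (t u : Term C n) → Pos X (eq {P = P} {n} {s} t u)
  par : ∀ {n s} {X : Fin s} (p : P) (t : Term C n) → Pos X (par {σ = σ} {n = n} {s} p t)
  mem : ∀ {n s} {X : Fin s} (Y : Fin s) (t : Term C n) → Pos X (mem {σ = σ} {P = P} Y t)
  neg : ∀ {n s} {X : Fin s} {φ : Form σ C P n s} → Neg X φ → Pos X (neg φ)
  and : ∀ {n s} {X : Fin s} {φ ψ : Form σ C P n s} → Pos X φ → Pos X ψ → Pos X (and φ ψ)
  or  : ∀ {n s} {X : Fin s} {φ ψ : Form σ C P n s} → Pos X φ → Pos X ψ → Pos X (or φ ψ)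
  ex  : ∀ {n s} {X : Fin s} {φ : Form σ C P (suc n) s} → Pos X φ → Pos X (ex φ)
  all : ∀ {n s} {X : Fin s} {φ : Form σ C P (suc n) s} → Pos X φ → Pos X (all φ)
  lfp : ∀ {n s} {X : Fin s} {φ : Form σ C P (suc n) (suc s)} (t : Term C n) →
        Pos (suc X) φ → Pos X (lfp φ t)

data Neg {σ} {C} {P} where
  rel : ∀ {n s} {X : Fin s} R (ts : Vec (Term C n) (ar σ R)) → Neg X (rel {n = n} {s} R ts)
  eq  : ∀ {n s} {X : Fin s} (t u : Term C n) → Neg X (eq {P = P} {n} {s} t u)
  par : ∀ {n s} {X : Fin s} (p : P) (t : Term C n) → Neg X (par {σ = σ} {n = n} {s} p t)
  mem : ∀ {n s} {X : Fin s} (Y : Fin s) (t : Term C n) → ¬ (Y ≡ X) →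
        Neg X (mem {σ = σ} {P = P} Y t)
  neg : ∀ {n s} {X : Fin s} {φ : Form σ C P n s} → Pos X φ → Neg X (neg φ)
  and : ∀ {n s} {X : Fin s} {φ ψ : Form σ C P n s} → Neg X φ → Neg X ψ → Neg X (and φ ψ)
  or  : ∀ {n s} {X : Fin s} {φ ψ : Form σ C P n s} → Neg X φ → Neg X ψ → Neg X (or φ ψ)
  ex  : ∀ {n s} {X : Fin s} {φ : Form σ C P (suc n) s} → Neg X φ → Neg X (ex φ)
  all : ∀ {n s} {X : Fin s} {φ : Form σ C P (suc n) s} → Neg X φ → Neg X (all φ)
  lfp : ∀ {n s} {X : Fin s} {φ : Form σ C P (suc n) (suc s)} (t : Term C n) →
        Neg (suc X) φ → Neg X (lfp φ t)

data WF {σ : Sig} {C P : Set} : ∀ {n s} → Form σ C P n s → Set where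
  rel : ∀ {n s} R (ts : Vec (Term C n) (ar σ R)) → WF (rel {n = n} {s} R ts)
  eq  : ∀ {n s} (t u : Term C n) → WF (eq {P = P} {n} {s} t u)
  par : ∀ {n s} (p : P) (t : Term C n) → WF (par {σ = σ} {n = n} {s} p t)
  mem : ∀ {n s} (Y : Fin s) (t : Term C n) → WF (mem {σ = σ} {P = P} Y t)
  neg : ∀ {n s} {φ : Form σ C P n s} → WF φ → WF (neg φ)
  and : ∀ {n s} {φ ψ : Form σ C P n s} → WF φ → WF ψ → WF (and φ ψ)
  or  : ∀ {n s} {φ ψ : Form σ C P n s} → WF φ → WF ψ → WF (or φ ψ)
  ex  : ∀ {n s} {φ : Form σ C P (suc n) s} → WF φ → WF (ex φ)
  all : ∀ {n s} {φ : Form σ C P (suc n) s} → WF φ → WF (all φ)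
  lfp : ∀ {n s} {φ : Form σ C P (suc n) (suc s)} (t : Term C n) →
        WF φ → Pos zero φ → WF (lfp φ t)

qd : ∀ {σ C P n s} → Form σ C P n s → ℕ
qd (rel R ts) = 0
qd (eq t u)   = 0
qd (par p t)  = 0
qd (mem X t)  = 0
qd (neg φ)    = qd φ
qd (and φ ψ)  = qd φ ⊔ qd ψ
qd (or φ ψ)   = qd φ ⊔ qd ψ
qd (ex φ)     = suc (qd φ)
qd (all φ)    = suc (qd φ)
qd (lfp φ t)  = suc (qd φ)

-- Henkin frames: admissible sets are given by an index type I with
-- extension ext : I → D → Set (𝔸 = { ext i | i : I }).

record Frame (σ : Sig) : Set₁ where
  field
    D   : Set
    I   : Set
    ext : I → D → Set
    Rel : (R : Sym σ) → Vec D (ar σ R) → Set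
open Frame public

evalT : ∀ {C n} {D : Set} → (C → D) → (Fin n → D) → Term C n → D
evalT c g (var x) = g x
evalT c g (con a) = c a

sat : ∀ {σ C P n s} (M : Frame σ) → (C → D M) → (P → D M → Set) →
      (Fin n → D M) → (Fin s → I M) → Form σ C P n s → Set
sat M c p g G (rel R ts) = Rel M R (vmap (evalT c g) ts)
sat M c p g G (eq t u)   = evalT c g t ≡ evalT c g u
sat M c p g G (par q t)  = p q (evalT c g t)
sat M c p g G (mem X t)  = ext M (G X) (evalT c g t)
sat M c p g G (neg φ)    = ¬ sat M c p g G φ
sat M c p g G (and φ ψ)  = sat M c p g G φ × sat M c p g G ψ
sat M c p g G (or φ ψ)   = sat M c p g G φ ⊎ sat M c p g G ψ
sat M c p g G (ex φ)     = Σ (D M) λ a → sat M c p (a ∷ᶠ g) G φ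
sat M c p g G (all φ)    = (a : D M) → sat M c p (a ∷ᶠ g) G φ
sat M c p g G (lfp φ t)  =
  (i : I M) → ((a : D M) → sat M c p (a ∷ᶠ g) (i ∷ᶠ G) φ → ext M i a) →
  ext M i (evalT c g t)

IsHenkin : ∀ {σ} → Frame σ → Set
IsHenkin {σ} M =
  ∀ {n s} (φ : Form σ ⊥ ⊥ (suc n) s) → WF φ →
  (g : Fin n → D M) (G : Fin s → I M) →
  Σ (I M) λ i → (a : D M) → ext M i a ⇔ sat M ⊥-elim ⊥-elim (a ∷ᶠ g) G φ

Equiv : ∀ {σ} {C P : Set} (n : ℕ) (M : Frame σ) → (C → D M) → (P → D M → Set) →
        (N : Frame σ) → (C → D N) → (P → D N → Set) → Set
Equiv {σ} {C} {P} n M c p N c' p' =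
  (φ : Form σ C P 0 0) → WF φ → qd φ ≤ n →
  sat M c p (λ ()) (λ ()) φ ⇔ sat N c' p' (λ ()) (λ ()) φ

-- quantifier-free first-order σ*-formulas in variables x_1..x_n,
-- σ* = σ ∪ {Q_1..Q_k}
data QF (σ : Sig) (k n : ℕ) : Set where
  qrel : (R : Sym σ) → Vec (Fin n) (ar σ R) → QF σ k n
  qeq  : Fin n → Fin n → QF σ k n
  qQ   : Fin k → Fin n → QF σ k n
  qneg : QF σ k n → QF σ k n
  qand : QF σ k n → QF σ k n → QF σ k n
  qor  : QF σ k n → QF σ k n → QF σ k n

-- domain of the disjoint union (disjointness realised by tagging)
UD : ∀ {σ k} → (Fin k → Frame σ) → Set
UD {k = k} M = Σ (Fin k) λ j → D (M j)

unionRel : ∀ {σ k} (M : Fin k → Frame σ) (R : Sym σ) → Vec (UD M) (ar σ R) → Set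
unionRel {σ} {k} M R t =
  Σ (Fin k) λ j → Σ (Vec (D (M j)) (ar σ R)) λ ds →
    (t ≡ vmap (λ d → (j , d)) ds) × Rel (M j) R ds

qsat : ∀ {σ k n} (M : Fin k → Frame σ) → (Fin n → UD M) → QF σ k n → Set
qsat M e (qrel R xs) = unionRel M R (vmap e xs)
qsat M e (qeq x y)   = e x ≡ e y
qsat M e (qQ j x)    = proj₁ (e x) ≡ j
qsat M e (qneg φ)    = ¬ qsat M e φ
qsat M e (qand φ ψ)  = qsat M e φ × qsat M e ψ
qsat M e (qor φ ψ)   = qsat M e φ ⊎ qsat M e ψ

-- the f-fusion ⊕^f_i M_i; admissible sets are ⋃_i A_i, A_i ∈ 𝔸_{M_i}
fusion : ∀ {σ k} (M : Fin k → Frame σ) → ((R : Sym σ) → QF σ k (ar σ R)) → Frame σ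
fusion {σ} {k} M f = record
  { D   = UD M
  ; I   = (j : Fin k) → I (M j)
  ; ext = λ G x → ext (M (proj₁ x)) (G (proj₁ x)) (proj₂ x)
  ; Rel = λ R t → qsat M (vlookup t) (f R)
  }

fuseCon : ∀ {σ k m} (M : Fin k → Frame σ) → ((j : Fin k) → Fin m → D (M j)) →
          Fin k × Fin m → UD M
fuseCon M a (j , r) = (j , a j r)

-- (Ā_1,…,Ā_k)^∪ : indexed by subsets S of the index set {(j,q)} of all
-- set parameters; the S-th predicate is ⋃_{(j,q) ∈ S} A_{j,q}
unionPar : ∀ {σ k m'} (M : Fin k → Frame σ) → ((j : Fin k) → Fin m' → I (M j)) →
           (Fin k × Fin m' → Bool) → UD M → Set
unionPar {m' = m'} M A S (j , d) =
  Σ (Fin m') λ q → (S (j , q) ≡ true) × ext (M j) (A j q) d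

{-# OPTIONS --safe #-}
module Submission where

-- Each formula φ of the fusion has finite lists L j of formulas of the components, of no larger
-- quantifier depth, such that φ transfers from one fusion to another as soon as every formula
-- of each L j transfers. The lists arise from replies in a one-sided Ehrenfeucht–Fraïssé game
-- restricted to finitely many formulas, where set variables carry polarities since fixed-point
-- formulas must be positive. The lfp move needs a set X in every component, although the
-- element that witnesses the move lies in only one of them. In the other components it is
-- anchored at a parameter c₀, which is why the parameter sequences must be non-empty.

open import Defs
open import Level using (0ℓ)
open import Axiom.ExcludedMiddle using (ExcludedMiddle)
open import Axiom.DoubleNegationElimination using (em⇒dne)
open import Data.Bool using (Bool; true; false; not)
open import Data.Empty using (⊥; ⊥-elim)
open import Data.Fin using (Fin; zero; suc; _≟_; fromℕ<)
open import Data.Fin.Properties using (suc-injective)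
open import Data.List using (List; []; _∷_; _++_; map; concat; filter; foldr; tabulate)
open import Data.List.Membership.Propositional using (_∈_; lose)
open import Data.List.Membership.Propositional.Properties
  using (∈-filter⁺; ∈-filter⁻; ∈-++⁺ˡ; ∈-++⁺ʳ; ∈-map⁺)
open import Data.List.Relation.Unary.All as All using (All; []; _∷_)
open import Data.List.Relation.Unary.All.Properties
  using (map⁺; map⁻; ++⁻ˡ; ++⁻ʳ; concat⁻; tabulate⁻; all-filter)
open import Data.List.Relation.Unary.Any using (Any; here; there)
open import Data.Nat using (ℕ; zero; suc; _⊔_; _≤_; z≤n; s≤s)
open import Data.Nat.Properties using (⊔-lub; m⊔n≤o⇒m≤o; m⊔n≤o⇒n≤o)
open import Data.Product using (Σ; ∃; ∃₂; _×_; _,_; proj₁; proj₂)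
open import Data.Sum using (_⊎_; inj₁; inj₂; [_,_])
open import Data.Vec using (Vec; []; _∷_) renaming (map to vmap; lookup to vlookup)
open import Data.Vec.Functional using () renaming (_∷_ to _∷ᶠ_)
open import Data.Vec.Properties using (∷-injective; lookup-map)
open import Function using (_∘_; id)
open import Function.Bundles using (_⇔_; mk⇔; Equivalence)
open import Relation.Binary.PropositionalEquality
  using (_≡_; _≢_; refl; sym; trans; cong; cong₂; subst)
open import Relation.Nullary using (¬_; Dec; yes; no)
open import Relation.Unary using (Pred; Decidable)

open Equivalence using (to; from)

-- Finite lists, and dependent functions with one prescribed value.

sublists : ∀ {A : Set} → List A → List (List A)
sublists []       = [] ∷ []
sublists (x ∷ xs) = map (x ∷_) (sublists xs) ++ sublists xs

-- The formulas of a list that hold, or fail, at a point form a `filter` by a classically decided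
-- predicate. So `sublists` enumerates all candidates before any structure is given.
filter∈sublists : ∀ {A : Set} {P : Pred A 0ℓ} (P? : Decidable P) xs →
                  filter P? xs ∈ sublists xs
filter∈sublists P? []       = here refl
filter∈sublists P? (x ∷ xs) with P? x
... | yes _ = ∈-++⁺ˡ (∈-map⁺ (x ∷_) (filter∈sublists P? xs))
... | no  _ = ∈-++⁺ʳ (map (x ∷_) (sublists xs)) (filter∈sublists P? xs)

-- A move in the fusion concerns one component; the others receive default values. The equation is
-- returned because `i ≟ i` does not reduce for a variable `i`.
override : ∀ {k} {P : Fin k → Set} → (∀ j → P j) → ∀ i (x : P i) →
           Σ (∀ j → P j) λ p → p i ≡ x
override {P = P} p i x = q , q-i
  where
  q : ∀ j → P j
  q j with i ≟ j
  ... | yes refl = x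
  ... | no  _    = p j
  q-i : q i ≡ x
  q-i with i ≟ i
  ... | yes refl = refl
  ... | no  i≢i  = ⊥-elim (i≢i refl)

,-injectiveʳ : ∀ {A : Set} {B : A → Set} {x} {y z : B x} →
               _≡_ {A = Σ A B} (x , y) (x , z) → y ≡ z
,-injectiveʳ refl = refl

-- Polarity of set variables, treated for both signs at once.

Pol : ∀ {σ C P n s} → Bool → Fin s → Form σ C P n s → Set
Pol true  = Pos
Pol false = Neg

module _ {σ : Sig} {C P : Set} where

  rel± : ∀ b {n s X} R (ts : Vec (Term C n) (ar σ R)) → Pol b X (rel {σ} {C} {P} {n} {s} R ts)
  rel± true  R ts = rel R ts
  rel± false R ts = rel R ts

  eq± : ∀ b {n s X} (t u : Term C n) → Pol b X (eq {σ} {C} {P} {n} {s} t u)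
  eq± true  t u = eq t u
  eq± false t u = eq t u

  par± : ∀ b {n s X} p (t : Term C n) → Pol b X (par {σ} {C} {P} {n} {s} p t)
  par± true  p t = par p t
  par± false p t = par p t

  module _ {n s : ℕ} where

    neg± : ∀ b {X : Fin s} {φ : Form σ C P n s} → Pol (not b) X φ → Pol b X (neg φ)
    neg± true  = neg
    neg± false = neg

    neg±⁻ : ∀ b {X : Fin s} {φ : Form σ C P n s} → Pol b X (neg φ) → Pol (not b) X φ
    neg±⁻ true  (neg p) = p
    neg±⁻ false (neg p) = p

    and± : ∀ b {X : Fin s} {φ ψ : Form σ C P n s} → Pol b X φ → Pol b X ψ → Pol b X (and φ ψ)
    and± true  = and
    and± false = and

    and±⁻ : ∀ b {X : Fin s} {φ ψ : Form σ C P n s} → Pol b X (and φ ψ) → Pol b X φ × Pol b X ψ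
    and±⁻ true  (and p q) = p , q
    and±⁻ false (and p q) = p , q

    or± : ∀ b {X : Fin s} {φ ψ : Form σ C P n s} → Pol b X φ → Pol b X ψ → Pol b X (or φ ψ)
    or± true  = or
    or± false = or

    or±⁻ : ∀ b {X : Fin s} {φ ψ : Form σ C P n s} → Pol b X (or φ ψ) → Pol b X φ × Pol b X ψ
    or±⁻ true  (or p q) = p , q
    or±⁻ false (or p q) = p , q

    ex± : ∀ b {X : Fin s} {φ : Form σ C P (suc n) s} → Pol b X φ → Pol b X (ex φ)
    ex± true  = ex
    ex± false = ex

    ex±⁻ : ∀ b {X : Fin s} {φ : Form σ C P (suc n) s} → Pol b X (ex φ) → Pol b X φ
    ex±⁻ true  (ex p) = p
    ex±⁻ false (ex p) = p

    all± : ∀ b {X : Fin s} {φ : Form σ C P (suc n) s} → Pol b X φ → Pol b X (all φ)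
    all± true  = all
    all± false = all

    all±⁻ : ∀ b {X : Fin s} {φ : Form σ C P (suc n) s} → Pol b X (all φ) → Pol b X φ
    all±⁻ true  (all p) = p
    all±⁻ false (all p) = p

    lfp± : ∀ b {X : Fin s} {φ : Form σ C P (suc n) (suc s)} {t} →
           Pol b (suc X) φ → Pol b X (lfp φ t)
    lfp± true  = lfp _
    lfp± false = lfp _

    lfp±⁻ : ∀ b {X : Fin s} {φ : Form σ C P (suc n) (suc s)} {t} →
            Pol b X (lfp φ t) → Pol b (suc X) φ
    lfp±⁻ true  (lfp _ p) = p
    lfp±⁻ false (lfp _ p) = p

-- Polarity of a membership atom depends on its set variable alone, so it passes from the language
-- of the fusion to that of a component.
mem± : ∀ b {σ C C′ P P′ n n′ s} {X Y : Fin s} {t : Term C n} →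
       Pol b X (mem {σ} {C} {P} Y t) → ∀ u → Pol b X (mem {σ} {C′} {P′} {n′} Y u)
mem± true  _             u = mem _ u
mem± false (mem _ _ Y≢X) u = mem _ u Y≢X

-- Replacing a set variable `X` by `X ∪ {c}`.

module Adjoin {σ : Sig} {C P : Set} (c : C) where

  -- The replacement only adds an equation as a disjunct at atoms, so neither quantifier depth nor
  -- polarity is affected.
  adjoin : ∀ {n s} → Fin s → Form σ C P n s → Form σ C P n s
  adjoin X (rel R ts) = rel R ts
  adjoin X (eq t u)   = eq t u
  adjoin X (par p t)  = par p t
  adjoin X (mem Y t)  with Y ≟ X
  ... | yes _ = or (mem Y t) (eq t (con c))
  ... | no  _ = mem Y t
  adjoin X (neg φ)    = neg (adjoin X φ)
  adjoin X (and φ ψ)  = and (adjoin X φ) (adjoin X ψ)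
  adjoin X (or φ ψ)   = or (adjoin X φ) (adjoin X ψ)
  adjoin X (ex φ)     = ex (adjoin X φ)
  adjoin X (all φ)    = all (adjoin X φ)
  adjoin X (lfp φ t)  = lfp (adjoin (suc X) φ) t

  adjoin-± : ∀ {n s} b {Y : Fin s} X (φ : Form σ C P n s) → Pol b Y φ → Pol b Y (adjoin X φ)
  adjoin-± b X (rel R ts) p = p
  adjoin-± b X (eq t u)   p = p
  adjoin-± b X (par q t)  p = p
  adjoin-± b X (mem Z t)  p with Z ≟ X
  ... | yes _ = or± b p (eq± b t (con c))
  ... | no  _ = p
  adjoin-± b X (neg φ)   p = neg± b (adjoin-± (not b) X φ (neg±⁻ b p))
  adjoin-± b X (and φ ψ) p with and±⁻ b p
  ... | p₁ , p₂ = and± b (adjoin-± b X φ p₁) (adjoin-± b X ψ p₂)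
  adjoin-± b X (or φ ψ)  p with or±⁻ b p
  ... | p₁ , p₂ = or± b (adjoin-± b X φ p₁) (adjoin-± b X ψ p₂)
  adjoin-± b X (ex φ)    p = ex± b (adjoin-± b X φ (ex±⁻ b p))
  adjoin-± b X (all φ)   p = all± b (adjoin-± b X φ (all±⁻ b p))
  adjoin-± b X (lfp φ t) p = lfp± b (adjoin-± b (suc X) φ (lfp±⁻ b p))

  adjoin-WF : ∀ {n s} (X : Fin s) {φ : Form σ C P n s} → WF φ → WF (adjoin X φ)
  adjoin-WF X (rel R ts) = rel R ts
  adjoin-WF X (eq t u)   = eq t u
  adjoin-WF X (par p t)  = par p t
  adjoin-WF X (mem Y t)  with Y ≟ X
  ... | yes _ = or (mem Y t) (eq t (con c))
  ... | no  _ = mem Y t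
  adjoin-WF X (neg w)    = neg (adjoin-WF X w)
  adjoin-WF X (and v w)  = and (adjoin-WF X v) (adjoin-WF X w)
  adjoin-WF X (or v w)   = or (adjoin-WF X v) (adjoin-WF X w)
  adjoin-WF X (ex w)     = ex (adjoin-WF X w)
  adjoin-WF X (all w)    = all (adjoin-WF X w)
  adjoin-WF X (lfp t w p) = lfp t (adjoin-WF (suc X) w) (adjoin-± true (suc X) _ p)

  qd-adjoin : ∀ {n s} (X : Fin s) (φ : Form σ C P n s) → qd (adjoin X φ) ≡ qd φ
  qd-adjoin X (rel R ts) = refl
  qd-adjoin X (eq t u)   = refl
  qd-adjoin X (par p t)  = refl
  qd-adjoin X (mem Y t)  with Y ≟ X
  ... | yes _ = refl
  ... | no  _ = refl
  qd-adjoin X (neg φ)    = qd-adjoin X φ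
  qd-adjoin X (and φ ψ)  = cong₂ _⊔_ (qd-adjoin X φ) (qd-adjoin X ψ)
  qd-adjoin X (or φ ψ)   = cong₂ _⊔_ (qd-adjoin X φ) (qd-adjoin X ψ)
  qd-adjoin X (ex φ)     = cong suc (qd-adjoin X φ)
  qd-adjoin X (all φ)    = cong suc (qd-adjoin X φ)
  qd-adjoin X (lfp φ t)  = cong suc (qd-adjoin (suc X) φ)

  module _ (M : Frame σ) (a : C → D M) (p : P → D M → Set) where

    -- Extensions are compared rather than indices, because `X ∪ {c}` is known only up to extension.
    Adjoined : ∀ {s} → Fin s → (G H : Fin s → I M) → Set
    Adjoined X G H = ∀ Y d → ext M (H Y) d ⇔ (ext M (G Y) d ⊎ (Y ≡ X × d ≡ a c))

    Adjoined-∷ : ∀ {s} {X : Fin s} {G H} i → Adjoined X G H → Adjoined (suc X) (i ∷ᶠ G) (i ∷ᶠ H)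
    Adjoined-∷ i ad zero    d = mk⇔ inj₁ [ id , (λ { (() , _) }) ]
    Adjoined-∷ i ad (suc Y) d = mk⇔
      (λ h → [ inj₁ , (λ (e , e′) → inj₂ (cong suc e , e′)) ] (to (ad Y d) h))
      (λ h → from (ad Y d) ([ inj₁ , (λ (e , e′) → inj₂ (suc-injective e , e′)) ] h))

    sat-adjoin : ∀ {n s} (X : Fin s) (φ : Form σ C P n s) {g G H} → Adjoined X G H →
                 sat M a p g G (adjoin X φ) ⇔ sat M a p g H φ
    sat-adjoin X (rel R ts) ad = mk⇔ id id
    sat-adjoin X (eq t u)   ad = mk⇔ id id
    sat-adjoin X (par q t)  ad = mk⇔ id id
    sat-adjoin X (mem Y t)  ad with Y ≟ X
    ... | yes Y≡X = mk⇔ (λ h → from (ad Y _) ([ inj₁ , (λ e → inj₂ (Y≡X , e)) ] h))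
                        (λ h → [ inj₁ , inj₂ ∘ proj₂ ] (to (ad Y _) h))
    ... | no  Y≢X = mk⇔ (λ h → from (ad Y _) (inj₁ h))
                        (λ h → [ id , (λ (e , _) → ⊥-elim (Y≢X e)) ] (to (ad Y _) h))
    sat-adjoin X (neg φ)    ad = let ih = sat-adjoin X φ ad in mk⇔ (_∘ from ih) (_∘ to ih)
    sat-adjoin X (and φ ψ)  ad =
      let ih = sat-adjoin X φ ad ; jh = sat-adjoin X ψ ad in
      mk⇔ (λ (x , y) → to ih x , to jh y) (λ (x , y) → from ih x , from jh y)
    sat-adjoin X (or φ ψ)   ad =
      let ih = sat-adjoin X φ ad ; jh = sat-adjoin X ψ ad in
      mk⇔ [ inj₁ ∘ to ih , inj₂ ∘ to jh ] [ inj₁ ∘ from ih , inj₂ ∘ from jh ]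
    sat-adjoin X (ex φ)     ad = mk⇔ (λ (d , h) → d , to (sat-adjoin X φ ad) h)
                                     (λ (d , h) → d , from (sat-adjoin X φ ad) h)
    sat-adjoin X (all φ)    ad = mk⇔ (λ h d → to (sat-adjoin X φ ad) (h d))
                                     (λ h d → from (sat-adjoin X φ ad) (h d))
    -- The bound set ranges over the same admissible sets on both sides; only the closure condition
    -- has to be translated.
    sat-adjoin X (lfp φ t)  ad = mk⇔
      (λ h i closed → h i λ d x → closed d (to (sat-adjoin (suc X) φ (Adjoined-∷ i ad)) x))
      (λ h i closed → h i λ d x → closed d (from (sat-adjoin (suc X) φ (Adjoined-∷ i ad)) x))

-- Formulas and environments of a single component.

module Local (em : ExcludedMiddle 0ℓ) {σ : Sig} {m m' : ℕ} (c₀ : Fin m) where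

  open Adjoin {σ} {Fin m} {Fin m'} c₀

  record Part : Set₁ where
    no-eta-equality
    field
      frame  : Frame σ
      henkin : IsHenkin frame
      cst    : Fin m → D frame
      prm    : Fin m' → I frame
  open Part public

  -- `π` prescribes a sign for every free set variable. Negation flips all signs, and `lfpᴸ` may
  -- bind a variable whose sign is `true`.
  record Loc {s : ℕ} (π : Fin s → Bool) (n d : ℕ) : Set where
    no-eta-equality
    field
      form  : Form σ (Fin m) (Fin m') n s
      wf    : WF form
      depth : qd form ≤ d
      polar : ∀ X → Pol (π X) X form
  open Loc public

  module _ {s : ℕ} {π : Fin s → Bool} {n d : ℕ} where

    relᴸ : ∀ R → Vec (Term (Fin m) n) (ar σ R) → Loc π n d
    relᴸ R ts = record
      { form = rel R ts ; wf = rel R ts ; depth = z≤n ; polar = λ X → rel± (π X) R ts }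

    eqᴸ : (t u : Term (Fin m) n) → Loc π n d
    eqᴸ t u = record
      { form = eq t u ; wf = eq t u ; depth = z≤n ; polar = λ X → eq± (π X) t u }

    parᴸ : Fin m' → Term (Fin m) n → Loc π n d
    parᴸ p t = record
      { form = par p t ; wf = par p t ; depth = z≤n ; polar = λ X → par± (π X) p t }

    negᴸ : Loc (not ∘ π) n d → Loc π n d
    negᴸ φ = record { form = neg (form φ) ; wf = neg (wf φ) ; depth = depth φ
                    ; polar = λ X → neg± (π X) (polar φ X) }

    andᴸ : Loc π n d → Loc π n d → Loc π n d
    andᴸ φ ψ = record { form = and (form φ) (form ψ) ; wf = and (wf φ) (wf ψ)
                      ; depth = ⊔-lub (depth φ) (depth ψ)
                      ; polar = λ X → and± (π X) (polar φ X) (polar ψ X) }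

    orᴸ : Loc π n d → Loc π n d → Loc π n d
    orᴸ φ ψ = record { form = or (form φ) (form ψ) ; wf = or (wf φ) (wf ψ)
                     ; depth = ⊔-lub (depth φ) (depth ψ)
                     ; polar = λ X → or± (π X) (polar φ X) (polar ψ X) }

    exᴸ : Loc π (suc n) d → Loc π n (suc d)
    exᴸ φ = record { form = ex (form φ) ; wf = ex (wf φ) ; depth = s≤s (depth φ)
                   ; polar = λ X → ex± (π X) (polar φ X) }

    allᴸ : Loc π (suc n) d → Loc π n (suc d)
    allᴸ φ = record { form = all (form φ) ; wf = all (wf φ) ; depth = s≤s (depth φ)
                    ; polar = λ X → all± (π X) (polar φ X) }

    lfpᴸ : Loc (true ∷ᶠ π) (suc n) d → Term (Fin m) n → Loc π n (suc d)
    lfpᴸ φ t = record { form = lfp (form φ) t ; wf = lfp t (wf φ) (polar φ zero)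
                      ; depth = s≤s (depth φ)
                      ; polar = λ X → lfp± (π X) (polar φ (suc X)) }

    adjoinᴸ : Fin s → Loc π n d → Loc π n d
    adjoinᴸ X φ = record { form = adjoin X (form φ) ; wf = adjoin-WF X (wf φ)
                         ; depth = subst (_≤ d) (sym (qd-adjoin X (form φ))) (depth φ)
                         ; polar = λ Y → adjoin-± (π Y) X (form φ) (polar φ Y) }

  module _ {s : ℕ} {π : Fin s → Bool} {n d : ℕ} where

    -- The syntax has no truth constants; the equation `c₀ = c₀` and its negation serve as the empty
    -- conjunction and disjunction.
    ⋀ : List (Loc π n d) → Loc π n d
    ⋀ = foldr andᴸ (eqᴸ (con c₀) (con c₀))

    ⋁ : List (Loc π n d) → Loc π n d
    ⋁ = foldr orᴸ (negᴸ (eqᴸ (con c₀) (con c₀)))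

  record LEnv (S : Part) (n s : ℕ) : Set where
    no-eta-equality
    constructor _∣_
    field
      elts : Fin n → D (frame S)
      sets : Fin s → I (frame S)
  open LEnv public

  value : ∀ {S : Part} {n s} → LEnv S n s → Term (Fin m) n → D (frame S)
  value {S} u t = evalT (cst S) (elts u) t

  module _ {S : Part} {n s : ℕ} where

    _▸_ : LEnv S n s → D (frame S) → LEnv S (suc n) s
    u ▸ x = (x ∷ᶠ elts u) ∣ sets u

    _▸[_]_ : LEnv S n s → I (frame S) → D (frame S) → LEnv S (suc n) (suc s)
    u ▸[ i ] x = (x ∷ᶠ elts u) ∣ (i ∷ᶠ sets u)

  Sat : ∀ {S : Part} {n s} → LEnv S n s → Form σ (Fin m) (Fin m') n s → Set
  Sat {S} u = sat (frame S) (cst S) (λ q → ext (frame S) (prm S q)) (elts u) (sets u)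

  module _ {s : ℕ} {π : Fin s → Bool} {n d : ℕ} {S : Part} (u : LEnv S n s) where

    Holds : Loc π n d → Set
    Holds φ = Sat u (form φ)

    ⋀⁺ : ∀ {L} → All Holds L → Holds (⋀ L)
    ⋀⁺ []       = refl
    ⋀⁺ (x ∷ xs) = x , ⋀⁺ xs

    ⋀⁻ : ∀ L → Holds (⋀ L) → All Holds L
    ⋀⁻ []      _        = []
    ⋀⁻ (_ ∷ L) (x , xs) = x ∷ ⋀⁻ L xs

    ⋁⁺ : ∀ {L} → Any Holds L → Holds (⋁ L)
    ⋁⁺ (here x)  = inj₁ x
    ⋁⁺ (there x) = inj₂ (⋁⁺ x)

    ⋁⁻ : ∀ L → Holds (⋁ L) → Any Holds L
    ⋁⁻ []      x        = ⊥-elim (x refl)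
    ⋁⁻ (_ ∷ L) (inj₁ x) = here x
    ⋁⁻ (_ ∷ L) (inj₂ x) = there (⋁⁻ L x)

  module _ {s : ℕ} {π : Fin s → Bool} {n d : ℕ} {S T : Part}
           (u : LEnv S n s) (v : LEnv T n s) where

    -- One direction only: an equivalence would call for negated formulas, which the positivity
    -- condition under `lfp` forbids.
    Preserved : Loc π n d → Set
    Preserved φ = Sat u (form φ) → Sat v (form φ)

  -- The finitely many formulas that encode a move.

  module _ {s : ℕ} {π : Fin s → Bool} {n d : ℕ} where

    exMoves : List (Loc π (suc n) d) → List (Loc π n (suc d))
    exMoves L = map (exᴸ ∘ ⋀) (sublists L)

    allMoves : List (Loc π (suc n) d) → List (Loc π n (suc d))
    allMoves L = map (allᴸ ∘ ⋁) (sublists L)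

    -- The bodies are the conjunctive normal forms over `L`; they stay positive in the bound
    -- variable because `L` is.
    lfpMoves : Term (Fin m) n → List (Loc (true ∷ᶠ π) (suc n) d) → List (Loc π n (suc d))
    lfpMoves t L = map (λ F → lfpᴸ (⋀ (map ⋁ F)) t) (sublists (sublists L))

    -- For play with a set from which `c₀` was removed: the adjoined formulas speak of the original
    -- set, and the head records that a point differs from `c₀`.
    punctured : List (Loc (true ∷ᶠ π) (suc n) d) → List (Loc (true ∷ᶠ π) (suc n) d)
    punctured L = negᴸ (eqᴸ (var zero) (con c₀)) ∷ map (adjoinᴸ zero) L

    freeMoves : List (Loc (true ∷ᶠ π) (suc n) d) → List (Loc π n (suc d))
    freeMoves L = lfpMoves (con c₀) L ++ lfpMoves (con c₀) (punctured L)

  dne : ∀ {A : Set} → ¬ ¬ A → A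
  dne = em⇒dne em

  ¬∀⇒∃¬ : ∀ {A : Set} {B : A → Set} → ¬ (∀ x → B x) → ∃ λ x → ¬ B x
  ¬∀⇒∃¬ h = dne λ k → h λ x → dne λ b → k (x , b)

  ¬→⇒× : ∀ {A B : Set} → ¬ (A → B) → A × ¬ B
  ¬→⇒× h = dne (λ k → h (⊥-elim ∘ k)) , λ b → h λ _ → b

  -- Replies to moves within one component.

  module Moves {s : ℕ} {π : Fin s → Bool} {n d : ℕ}
               {S T : Part} (u : LEnv S n s) (v : LEnv T n s) where

    -- With `L₁` the formulas of `L` true at `x`, the sentence-like formula `∃⋀L₁` passes from `u`
    -- to `v`, and its witness is the reply.
    ex-reply : (L : List (Loc π (suc n) d)) → All (Preserved u v) (exMoves L) →
               ∀ x → ∃ λ y → All (Preserved (u ▸ x) (v ▸ y)) L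
    ex-reply L pres x =
      let true? = λ ψ → em {Holds (u ▸ x) ψ}
          L₁    = filter true? L
          y , h = All.lookup (map⁻ pres) (filter∈sublists true? L)
                    (x , ⋀⁺ (u ▸ x) (all-filter true? L))
      in  y , All.tabulate λ ψ∈L sx →
                All.lookup (⋀⁻ (v ▸ y) L₁ h) (∈-filter⁺ true? ψ∈L sx)

    -- Dually, with `L₁` the formulas of `L` false at `y`, `∀⋁L₁` fails at `v`, hence at `u`, and a
    -- point refuting it is the reply.
    all-reply : (L : List (Loc π (suc n) d)) → All (Preserved u v) (allMoves L) →
                ∀ y → ∃ λ x → All (Preserved (u ▸ x) (v ▸ y)) L
    all-reply L pres y =
      let false? = λ ψ → em {¬ Holds (v ▸ y) ψ}
          L₁     = filter false? L
          x , h  = ¬∀⇒∃¬ λ sx →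
                     let holds = ⋁⁻ (v ▸ y) L₁
                                   (All.lookup (map⁻ pres) (filter∈sublists false? L) sx y)
                         f , t = All.lookupAny (all-filter false? L) holds
                     in  f t
      in  x , All.tabulate λ ψ∈L sx → dne λ ty →
                h (⋁⁺ (u ▸ x) (lose (∈-filter⁺ false? ψ∈L ty) sx))

    -- The fixed-point formula played is that of ⋀⋁F, where F consists of the sets of formulas of L
    -- that contain all formulas failing at some point outside Y.
    lfp-reply : ∀ t (L : List (Loc (true ∷ᶠ π) (suc n) d)) →
                All (Preserved u v) (lfpMoves t L) →
                ∀ Y → ¬ ext (frame T) Y (value v t) →
                ∃ λ X → ¬ ext (frame S) X (value u t) ×
                  (∀ x → ¬ ext (frame S) X x → ∃ λ y → ¬ ext (frame T) Y y ×
                    All (Preserved (u ▸[ X ] x) (v ▸[ Y ] y)) L)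
    lfp-reply t L pres Y t∉Y = X , t∉X , reply
      where
      Failing : D (frame T) → Loc (true ∷ᶠ π) (suc n) d → Set
      Failing y ψ = ¬ Holds (v ▸[ Y ] y) ψ

      Realised : List (Loc (true ∷ᶠ π) (suc n) d) → Set
      Realised L₁ = ∃ λ y → ¬ ext (frame T) Y y × (∀ {ψ} → ψ ∈ L → Failing y ψ → ψ ∈ L₁)

      realised? : Decidable Realised
      realised? _ = em

      F = filter realised? (sublists L)

      -- For `y` outside `Y`, the list of formulas failing at `y` belongs to `F`, so the conjunction
      -- would make one of them true.
      Y-closed : ∀ y → Holds (v ▸[ Y ] y) (⋀ (map ⋁ F)) → ext (frame T) Y y
      Y-closed y h = dne λ y∉Y →
        let fails? = λ ψ → em {Failing y ψ}
            L₁     = filter fails? L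
            L₁∈F   = ∈-filter⁺ realised? (filter∈sublists fails? L)
                       (y , y∉Y , ∈-filter⁺ fails?)
            holds  = ⋁⁻ (v ▸[ Y ] y) L₁
                       (All.lookup (map⁻ (⋀⁻ (v ▸[ Y ] y) (map ⋁ F) h)) L₁∈F)
            f , x  = All.lookupAny (all-filter fails? L) holds
        in  f x

      -- `Y` is closed and misses `t`, so the fixed-point formula fails at `v`, hence at `u`. The
      -- failure at `u` supplies the set `X`.
      counterexample = ¬∀⇒∃¬ λ h →
        t∉Y (All.lookup (map⁻ pres) (filter∈sublists realised? (sublists L)) h Y Y-closed)

      X = proj₁ counterexample
      X-closed = proj₁ (¬→⇒× (proj₂ counterexample))
      t∉X = proj₂ (¬→⇒× (proj₂ counterexample))

      reply : ∀ x → ¬ ext (frame S) X x → ∃ λ y → ¬ ext (frame T) Y y ×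
                All (Preserved (u ▸[ X ] x) (v ▸[ Y ] y)) L
      -- Since `X` is closed, some disjunction `⋁ L₁` with `L₁` in `F` fails at `x`. A point
      -- realising `L₁` is the reply: whatever fails there is in `L₁` and so fails at `x`.
      reply x x∉X =
        let L₁ , k             = ¬∀⇒∃¬ {B = λ L₁ → L₁ ∈ F → Holds (u ▸[ X ] x) (⋁ L₁)}
                                   λ h → x∉X (X-closed x (⋀⁺ (u ▸[ X ] x)
                                     (map⁺ (All.tabulate (λ {L₁} → h L₁)))))
            L₁∈F , ⋁L₁-fails   = ¬→⇒× k
            y , y∉Y , fails∈L₁ = proj₂ (∈-filter⁻ realised? {xs = sublists L} L₁∈F)
        in  y , y∉Y , All.tabulate λ ψ∈L sx → dne λ ty →
              ⋁L₁-fails (⋁⁺ (u ▸[ X ] x) (lose (fails∈L₁ ψ∈L ty) sx))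

  -- Set moves in components that do not contain the tested element.

  -- The Henkin condition enters here and in `adding`: the modified set is definable from the
  -- parameters `i` and `z`, hence admissible.
  without : (S : Part) (i : I (frame S)) (z : D (frame S)) →
            ∃ λ j → ∀ x → ext (frame S) j x ⇔ (ext (frame S) i x × x ≢ z)
  without S i z =
    henkin S {1} {1} (and (mem zero (var zero)) (neg (eq (var zero) (var (suc zero)))))
           (and (mem _ _) (neg (eq _ _))) (λ _ → z) (λ _ → i)

  adding : (S : Part) (i : I (frame S)) (z : D (frame S)) →
           ∃ λ j → ∀ x → ext (frame S) j x ⇔ (ext (frame S) i x ⊎ x ≡ z)
  adding S i z =
    henkin S {1} {1} (or (mem zero (var zero)) (eq (var zero) (var (suc zero))))
           (or (mem _ _) (eq _ _)) (λ _ → z) (λ _ → i)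

  without-adding : ∀ {A : Set} {P P′ : A → Set} {c} → P c →
                   (∀ x → P′ x ⇔ (P x × x ≢ c)) → ∀ x → P x ⇔ (P′ x ⊎ x ≡ c)
  without-adding {P = P} {P′} {c} Pc P′⇔ x = mk⇔ split [ proj₁ ∘ to (P′⇔ x) , (λ { refl → Pc }) ]
    where
    split : P x → P′ x ⊎ x ≡ c
    split Px with em {x ≡ c}
    ... | yes x≡c = inj₂ x≡c
    ... | no  x≢c = inj₁ (from (P′⇔ x) (Px , x≢c))

  sat-adjoin-zero : ∀ {n s} (S : Part) (u : LEnv S n s) {i j : I (frame S)} {x} →
    (∀ y → ext (frame S) j y ⇔ (ext (frame S) i y ⊎ y ≡ cst S c₀)) →
    (φ : Form σ (Fin m) (Fin m') (suc n) (suc s)) →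
    Sat (u ▸[ i ] x) (adjoin zero φ) ⇔ Sat (u ▸[ j ] x) φ
  sat-adjoin-zero S u {i} {j} h φ =
    sat-adjoin (frame S) (cst S) (λ q → ext (frame S) (prm S q)) zero φ adjoined
    where
    adjoined : Adjoined (frame S) (cst S) (λ q → ext (frame S) (prm S q)) zero
                 (i ∷ᶠ sets u) (j ∷ᶠ sets u)
    adjoined zero    y = mk⇔ (λ e → [ inj₁ , (λ y≡c → inj₂ (refl , y≡c)) ] (to (h y) e))
                             (λ e → from (h y) ([ inj₁ , inj₂ ∘ proj₂ ] e))
    adjoined (suc _) y = mk⇔ inj₁ [ id , (λ { (() , _) }) ]

  module FreeMove {s : ℕ} {π : Fin s → Bool} {n d : ℕ}
                  {S T : Part} (u : LEnv S n s) (v : LEnv T n s) where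

    -- The second clause supplies a default pair of matching points, used when the point under
    -- discussion lies in another component.
    Reply : List (Loc (true ∷ᶠ π) (suc n) d) → I (frame S) → I (frame T) → Set
    Reply L X Y =
      (∀ x → ¬ ext (frame S) X x → ∃ λ y → ¬ ext (frame T) Y y ×
         All (Preserved (u ▸[ X ] x) (v ▸[ Y ] y)) L) ×
      (∃₂ λ x y → All (Preserved (u ▸[ X ] x) (v ▸[ Y ] y)) L)

    open Moves {π = π} {d = d} u v

    -- The fixed-point formula at `c₀` yields a set `X` missing `c₀`, so the answer to `c₀` itself
    -- gives the default pair.
    reply-outside : (L : List (Loc (true ∷ᶠ π) (suc n) d)) →
                    All (Preserved u v) (lfpMoves (con c₀) L) →
                    ∀ Y → ¬ ext (frame T) Y (cst T c₀) → ∃ λ X → Reply L X Y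
    reply-outside L pres Y c∉Y =
      let X , c∉X , reply = lfp-reply (con c₀) L pres Y c∉Y
          y , _ , p       = reply (cst S c₀) c∉X
      in  X , reply , (cst S c₀ , y , p)

    restore : (L : List (Loc (true ∷ᶠ π) (suc n) d)) → ∀ {X X′ Y Y′} →
      (∀ x → ext (frame S) X x ⇔ (ext (frame S) X′ x ⊎ x ≡ cst S c₀)) →
      (∀ y → ext (frame T) Y y ⇔ (ext (frame T) Y′ y ⊎ y ≡ cst T c₀)) → ∀ {x y} →
      All (Preserved (u ▸[ X′ ] x) (v ▸[ Y′ ] y)) (map (adjoinᴸ zero) L) →
      All (Preserved (u ▸[ X ] x) (v ▸[ Y ] y)) L
    restore L X⇔ Y⇔ p =
      All.map (λ {ψ} q → to (sat-adjoin-zero T v Y⇔ (form ψ)) ∘ q ∘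
                         from (sat-adjoin-zero S u X⇔ (form ψ)))
              (map⁻ p)

    restore-reply : (L : List (Loc (true ∷ᶠ π) (suc n) d)) → ∀ {X X′ Y Y′} →
      (∀ x → ext (frame S) X x ⇔ (ext (frame S) X′ x ⊎ x ≡ cst S c₀)) →
      (∀ y → ext (frame T) Y y ⇔ (ext (frame T) Y′ y ⊎ y ≡ cst T c₀)) →
      ¬ ext (frame S) X′ (cst S c₀) →
      (∀ x → ¬ ext (frame S) X′ x → ∃ λ y → ¬ ext (frame T) Y′ y ×
         All (Preserved (u ▸[ X′ ] x) (v ▸[ Y′ ] y)) (punctured L)) →
      Reply L X Y
    restore-reply L {X} {X′} {Y} {Y′} X⇔ Y⇔ c∉X′ reply =
      (λ x x∉X → outside x x∉X (reply x (x∉X ∘ from (X⇔ x) ∘ inj₁))) ,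
      (let y , _ , p = reply (cst S c₀) c∉X′ in cst S c₀ , y , restore L X⇔ Y⇔ (All.tail p))
      where
      outside : ∀ x → ¬ ext (frame S) X x →
        (∃ λ y → ¬ ext (frame T) Y′ y ×
           All (Preserved (u ▸[ X′ ] x) (v ▸[ Y′ ] y)) (punctured L)) →
        ∃ λ y → ¬ ext (frame T) Y y × All (Preserved (u ▸[ X ] x) (v ▸[ Y ] y)) L
      outside x x∉X (y , y∉Y′ , (≢c ∷ p)) =
        -- As `c₀` lies in `X`, the point `x` differs from `c₀`. The head of `punctured` carries
        -- this over to `y`, so `y` avoids all of `Y` and not merely `Y′`.
        y , (λ y∈Y → [ y∉Y′ , ≢c (x∉X ∘ from (X⇔ x) ∘ inj₂) ] (to (Y⇔ y) y∈Y)) ,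
        restore L X⇔ Y⇔ p

    -- An lfp formula at c₀ can only speak about sets missing c₀, so if c₀ ∈ Y
    -- the move is played with Y ∖ {c₀} and c₀ is put back afterwards.
    reply-inside : (L : List (Loc (true ∷ᶠ π) (suc n) d)) →
                   All (Preserved u v) (lfpMoves (con c₀) (punctured L)) →
                   ∀ Y → ext (frame T) Y (cst T c₀) → ∃ λ X → Reply L X Y
    reply-inside L pres Y c∈Y =
      let Y′ , Y′⇔          = without T Y (cst T c₀)
          X′ , c∉X′ , reply = lfp-reply (con c₀) (punctured L) pres Y′
                                (λ c∈Y′ → proj₂ (to (Y′⇔ _) c∈Y′) refl)
          X , X⇔            = adding S X′ (cst S c₀)
      in  X , restore-reply L X⇔ (without-adding c∈Y Y′⇔) c∉X′ reply

    free-reply : (L : List (Loc (true ∷ᶠ π) (suc n) d)) →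
                 All (Preserved u v) (freeMoves L) → ∀ Y → ∃ λ X → Reply L X Y
    free-reply L pres Y = by-cases em
      where
      by-cases : Dec (ext (frame T) Y (cst T c₀)) → ∃ λ X → Reply L X Y
      by-cases (yes c∈Y) = reply-inside L (++⁻ʳ (lfpMoves (con c₀) L) pres) Y c∈Y
      by-cases (no c∉Y)  = reply-outside L (++⁻ˡ (lfpMoves (con c₀) L) pres) Y c∉Y

-- Terms and environments of the fusion.

module Fusion (em : ExcludedMiddle 0ℓ) {σ : Sig} {k m m' : ℕ} (c₀ : Fin m)
              (f : (R : Sym σ) → QF σ k (ar σ R)) where

  open Local em {σ} {m} {m'} c₀

  FTerm : ℕ → Set
  FTerm = Term (Fin k × Fin m)

  FForm : ℕ → ℕ → Set
  FForm = Form σ (Fin k × Fin m) (Fin k × Fin m' → Bool)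

  Parts : Set₁
  Parts = Fin k → Part

  -- Given `τ`, the component of a term is syntactic, hence the same in both fusions.
  place : ∀ {n} → (Fin n → Fin k) → FTerm n → Fin k
  place τ (var x)       = τ x
  place τ (con (j , _)) = j

  loc : ∀ {n} → FTerm n → Term (Fin m) n
  loc (var x)       = var x
  loc (con (_ , r)) = con r

  FD : Parts → Set
  FD S = UD (frame ∘ S)

  FI : Parts → Set
  FI S = ∀ j → I (frame (S j))

  -- Every component values all first-order variables; only the value in the component
  -- τ x that x is placed in is relevant, the others are arbitrary.
  record FEnv (S : Parts) {n : ℕ} (τ : Fin n → Fin k) (s : ℕ) : Set where
    no-eta-equality
    field
      env       : ∀ j → LEnv (S j) n s
      felts     : Fin n → FD S
      fsets     : Fin s → FI S
      felts-env : ∀ x → felts x ≡ (τ x , elts (env (τ x)) x)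
      fsets-env : ∀ X j → fsets X j ≡ sets (env j) X
  open FEnv

  FSat : ∀ {S n s} {τ : Fin n → Fin k} → FEnv S τ s → FForm n s → Set
  FSat {S} u = sat (fusion (frame ∘ S) f) (fuseCon (frame ∘ S) (λ j → cst (S j)))
                   (unionPar (frame ∘ S) (λ j → prm (S j))) (felts u) (fsets u)

  point : ∀ {S n s} {τ : Fin n → Fin k} → FEnv S τ s → FTerm n → FD S
  point {τ = τ} u t = place τ t , value (env u (place τ t)) (loc t)

  fvalue : ∀ {S n s} {τ : Fin n → Fin k} → FEnv S τ s → FTerm n → FD S
  fvalue {S} u = evalT (fuseCon (frame ∘ S) (λ j → cst (S j))) (felts u)

  fvalue≡point : ∀ {S n s} {τ : Fin n → Fin k} (u : FEnv S τ s) t → fvalue u t ≡ point u t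
  fvalue≡point u (var x) = felts-env u x
  fvalue≡point u (con _) = refl

  extend : ∀ {S n s} {τ : Fin n → Fin k} → FEnv S τ s → ∀ i (xs : ∀ j → D (frame (S j))) →
           FEnv S (i ∷ᶠ τ) s
  extend u i xs = record
    { env       = λ j → env u j ▸ xs j
    ; felts     = (i , xs i) ∷ᶠ felts u
    ; fsets     = fsets u
    ; felts-env = λ { zero → refl ; (suc x) → felts-env u x }
    ; fsets-env = fsets-env u
    }

  extendSet : ∀ {S n s} {τ : Fin n → Fin k} → FEnv S τ s → FI S →
              ∀ i (xs : ∀ j → D (frame (S j))) → FEnv S (i ∷ᶠ τ) (suc s)
  extendSet u Y i xs = record
    { env       = λ j → env u j ▸[ Y j ] xs j
    ; felts     = (i , xs i) ∷ᶠ felts u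
    ; fsets     = Y ∷ᶠ fsets u
    ; felts-env = λ { zero → refl ; (suc x) → felts-env u x }
    ; fsets-env = λ { zero j → refl ; (suc X) j → fsets-env u X j }
    }

  PreservedAll : ∀ {S T n d s} {π : Fin s → Bool} {τ : Fin n → Fin k} →
                 FEnv S τ s → FEnv T τ s → (Fin k → List (Loc π n d)) → Set
  PreservedAll u v L = ∀ j → All (Preserved (env u j) (env v j)) (L j)

  -- Transfer of the quantifier-free formulas that define the fused relations.

  module _ {n d s : ℕ} {π : Fin s → Bool} where

    atom± : (∀ {ρ} → Loc {s} ρ n d) → List (Loc π n d)
    atom± φ = φ ∷ negᴸ φ ∷ []

    -- Each atom comes with its negation, since it may occur under either sign in `q`; this is
    -- harmless for polarity as no set variable occurs. A predicate `Q_j` contributes nothing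
    -- because `τ` already decides it.
    qfTypes : ∀ {l} → (Fin l → FTerm n) → QF σ k l → List (Loc π n d)
    qfTypes ts (qrel R xs) = atom± (relᴸ R (vmap (loc ∘ ts) xs))
    qfTypes ts (qeq x y)   = atom± (eqᴸ (loc (ts x)) (loc (ts y)))
    qfTypes ts (qQ j x)    = []
    qfTypes ts (qneg q)    = qfTypes ts q
    qfTypes ts (qand q r)  = qfTypes ts q ++ qfTypes ts r
    qfTypes ts (qor q r)   = qfTypes ts q ++ qfTypes ts r

    module _ {S T : Parts} {τ : Fin n → Fin k} (u : FEnv S τ s) (v : FEnv T τ s) where

      point-eq : ∀ i j t t′ →
        (value (env u i) t ≡ value (env u i) t′ → value (env v i) t ≡ value (env v i) t′) →
        _≡_ {A = FD S} (i , value (env u i) t) (j , value (env u j) t′) →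
        _≡_ {A = FD T} (i , value (env v i) t) (j , value (env v j) t′)
      point-eq i j t t′ h e with cong proj₁ e
      ... | refl = cong (i ,_) (h (,-injectiveʳ e))

      -- A tuple related in the disjoint union lies in one component `j`. All its terms are then
      -- placed in `j`, which forces the corresponding tuple on the other side into `j` too.
      tuple : ∀ {l a} (ts : Fin l → FTerm n) {e : Fin l → FD S} {e′ : Fin l → FD T} →
        (∀ x → e x ≡ point u (ts x)) → (∀ x → e′ x ≡ point v (ts x)) →
        ∀ j (xs : Vec (Fin l) a) ds → vmap e xs ≡ vmap (j ,_) ds →
        ds ≡ vmap (value (env u j)) (vmap (loc ∘ ts) xs) ×
        vmap e′ xs ≡ vmap (j ,_) (vmap (value (env v j)) (vmap (loc ∘ ts) xs))
      tuple ts e≡ e′≡ j []       []       _ = refl , refl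
      tuple ts {e} {e′} e≡ e′≡ j (x ∷ xs) (y ∷ ds) p =
        let p₁ , p₂ = ∷-injective p
            q₁ , q₂ = component (place τ (ts x)) (trans (sym (e≡ x)) p₁)
            r₁ , r₂ = tuple ts {e} {e′} e≡ e′≡ j xs ds p₂
        in  cong₂ _∷_ q₁ r₁ , cong₂ _∷_ (trans (e′≡ x) q₂) r₂
        where
        component : ∀ i → _≡_ {A = FD S} (i , value (env u i) (loc (ts x))) (j , y) →
          y ≡ value (env u j) (loc (ts x)) ×
          _≡_ {A = FD T} (i , value (env v i) (loc (ts x))) (j , value (env v j) (loc (ts x)))
        component i refl = refl , refl

  negated : ∀ {n d s} {π : Fin s → Bool} {S T : Part} {u : LEnv S n s} {v : LEnv T n s}
            (φ : ∀ {ρ} → Loc {s} ρ n d) → All (Preserved {π = π} u v) (atom± φ) →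
            Sat v (form (φ {not ∘ π})) → Sat u (form (φ {not ∘ π}))
  negated φ (_ ∷ neg-φ ∷ []) h = dne λ k → neg-φ k h

  qf-transfer : ∀ {n d s l} {π : Fin s → Bool} (ts : Fin l → FTerm n) (q : QF σ k l)
    {S T} {τ : Fin n → Fin k} (u : FEnv S τ s) (v : FEnv T τ s) →
    PreservedAll u v (λ _ → qfTypes {d = d} {π = π} ts q) →
    ∀ {e e′} → (∀ x → e x ≡ point u (ts x)) → (∀ x → e′ x ≡ point v (ts x)) →
    qsat (frame ∘ S) e q ⇔ qsat (frame ∘ T) e′ q
  qf-transfer {d = d} {π = π} ts (qrel R xs) {S} {T} u v pres {e} {e′} e≡ e′≡ = mk⇔ fwd bwd
    where
    fwd : unionRel (frame ∘ S) R (vmap e xs) → unionRel (frame ∘ T) R (vmap e′ xs)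
    fwd (j , ds , p , r) =
      let q₁ , q₂ = tuple {d = d} {π = π} u v ts e≡ e′≡ j xs ds p
      in  j , _ , q₂ , All.head (pres j) (subst (Rel (frame (S j)) R) q₁ r)
    bwd : unionRel (frame ∘ T) R (vmap e′ xs) → unionRel (frame ∘ S) R (vmap e xs)
    bwd (j , ds , p , r) =
      let q₁ , q₂ = tuple {d = d} {π = π} v u ts e′≡ e≡ j xs ds p
      in  j , _ , q₂ , negated {u = env u j} {env v j} (relᴸ R (vmap (loc ∘ ts) xs)) (pres j)
                         (subst (Rel (frame (T j)) R) q₁ r)
  qf-transfer {d = d} {π = π} ts (qeq x y) u v pres e≡ e′≡ = mk⇔
    (λ p → trans (e′≡ x) (trans
       (point-eq {d = d} {π = π} u v _ _ (loc (ts x)) (loc (ts y)) (All.head (pres _))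
         (trans (sym (e≡ x)) (trans p (e≡ y)))) (sym (e′≡ y))))
    (λ p → trans (e≡ x) (trans
       (point-eq {d = d} {π = π} v u _ _ (loc (ts x)) (loc (ts y))
         (negated {u = env u _} {env v _} (eqᴸ (loc (ts x)) (loc (ts y))) (pres _))
         (trans (sym (e′≡ x)) (trans p (e′≡ y)))) (sym (e≡ y))))
  qf-transfer ts (qQ j x) u v pres e≡ e′≡ = mk⇔
    (λ p → trans (cong proj₁ (e′≡ x)) (trans (cong proj₁ (sym (e≡ x))) p))
    (λ p → trans (cong proj₁ (e≡ x)) (trans (cong proj₁ (sym (e′≡ x))) p))
  qf-transfer ts (qneg q) u v pres e≡ e′≡ =
    let ih = qf-transfer ts q u v pres e≡ e′≡ in mk⇔ (_∘ from ih) (_∘ to ih)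
  qf-transfer ts (qand q r) u v pres e≡ e′≡ =
    let ih = qf-transfer ts q u v (λ j → ++⁻ˡ (qfTypes ts q) (pres j)) e≡ e′≡
        jh = qf-transfer ts r u v (λ j → ++⁻ʳ (qfTypes ts q) (pres j)) e≡ e′≡
    in  mk⇔ (λ (x , y) → to ih x , to jh y) (λ (x , y) → from ih x , from jh y)
  qf-transfer ts (qor q r) u v pres e≡ e′≡ =
    let ih = qf-transfer ts q u v (λ j → ++⁻ˡ (qfTypes ts q) (pres j)) e≡ e′≡
        jh = qf-transfer ts r u v (λ j → ++⁻ʳ (qfTypes ts q) (pres j)) e≡ e′≡
    in  mk⇔ [ inj₁ ∘ to ih , inj₂ ∘ to jh ] [ inj₁ ∘ from ih , inj₂ ∘ from jh ]

  -- Reduction of formulas of the fusion to lists of local formulas.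

  -- The lists are fixed before the structures, so the same lists serve with the two sides
  -- exchanged, as negation requires.
  Reduces : ∀ {n s d} {π : Fin s → Bool} (τ : Fin n → Fin k) → FForm n s →
            (Fin k → List (Loc π n d)) → Set₁
  Reduces {s = s} τ φ L = ∀ {S T} (u : FEnv S τ s) (v : FEnv T τ s) →
                          PreservedAll u v L → FSat u φ → FSat v φ

  module _ {n s d : ℕ} {π : Fin s → Bool} where

    -- The component `i` of a newly bound variable is not known in advance, so each component `j`
    -- prepares for every `i`.
    spread : (Fin k → Fin k → List (Loc π n d)) → Fin k → List (Loc π n d)
    spread L j = concat (tabulate (λ i → L i j))

    unspread : ∀ {S T τ} (u : FEnv S τ s) (v : FEnv T τ s) (L : Fin k → Fin k → List (Loc π n d)) →
               PreservedAll u v (spread L) → ∀ i → PreservedAll u v (L i)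
    unspread u v L pres i j = tabulate⁻ (concat⁻ (pres j)) i

  setMoves : ∀ {n s d} {π : Fin s → Bool} → Term (Fin m) n →
             List (Loc (true ∷ᶠ π) (suc n) d) → List (Loc π n (suc d))
  setMoves t L = lfpMoves t L ++ freeMoves L

  module _ {n s d : ℕ} {π : Fin s → Bool} {S T : Part} (u : LEnv S n s) (v : LEnv T n s) where

    open FreeMove {π = π} {d = d} u v using (Reply; free-reply)
    open Moves {π = π} {d = d} u v using (lfp-reply)

    -- `A` stands for the component being the one that contains `t`. There the formula is played at
    -- `t`, and the answer to `t` gives the default pair; elsewhere the free move anchored at `c₀`
    -- is used.
    set-reply : ∀ t (L : List (Loc (true ∷ᶠ π) (suc n) d)) →
                All (Preserved u v) (setMoves t L) →
                ∀ {A : Set} → Dec A → ∀ Y → (A → ¬ ext (frame T) Y (value v t)) →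
                ∃ λ X → Reply L X Y × (A → ¬ ext (frame S) X (value u t))
    set-reply t L pres (yes a) Y t∉Y =
      let X , t∉X , reply = lfp-reply t L (++⁻ˡ (lfpMoves t L) pres) Y (t∉Y a)
          y , _ , p       = reply (value u t) t∉X
      in  X , (reply , (value u t , y , p)) , λ _ → t∉X
    set-reply t L pres (no ¬a) Y t∉Y =
      let X , reply = free-reply L (++⁻ʳ (lfpMoves t L) pres) Y
      in  X , reply , λ a → ⊥-elim (¬a a)

  reduces-ex : ∀ {n s d} {π : Fin s → Bool} {τ : Fin n → Fin k} (φ : FForm (suc n) s)
    (L : Fin k → Fin k → List (Loc π (suc n) d)) → (∀ i → Reduces (i ∷ᶠ τ) φ (L i)) →
    Reduces τ (ex φ) (exMoves ∘ spread L)
  -- The witness is played in component `i`, and `c₀` as a dummy element everywhere else.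
  reduces-ex φ L red {S} {T} u v pres ((i , x) , h) with override (λ j → cst (S j) c₀) i x
  ... | xs , refl =
    let replies = λ j → Moves.ex-reply (env u j) (env v j) (spread L j) (pres j) (xs j)
        u′ = extend u i xs
        v′ = extend v i (proj₁ ∘ replies)
    in  _ , red i u′ v′ (unspread u′ v′ L (proj₂ ∘ replies) i) h

  reduces-all : ∀ {n s d} {π : Fin s → Bool} {τ : Fin n → Fin k} (φ : FForm (suc n) s)
    (L : Fin k → Fin k → List (Loc π (suc n) d)) → (∀ i → Reduces (i ∷ᶠ τ) φ (L i)) →
    Reduces τ (all φ) (allMoves ∘ spread L)
  reduces-all φ L red {S} {T} u v pres h (i , y) with override (λ j → cst (T j) c₀) i y
  ... | ys , refl =
    let replies = λ j → Moves.all-reply (env u j) (env v j) (spread L j) (pres j) (ys j)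
        u′ = extend u i (proj₁ ∘ replies)
        v′ = extend v i ys
    in  red i u′ v′ (unspread u′ v′ L (proj₂ ∘ replies) i) (h _)

  -- A closed `Y` missing `t` is answered componentwise. The union of the answers is closed and
  -- misses `t`, contradicting the fixed-point formula on the left; to miss `t`, only the component
  -- of `t` matters.
  reduces-lfp : ∀ {n s d} {π : Fin s → Bool} {τ : Fin n → Fin k} (φ : FForm (suc n) (suc s)) t
    (L : Fin k → Fin k → List (Loc (true ∷ᶠ π) (suc n) d)) →
    (∀ i → Reduces (i ∷ᶠ τ) φ (L i)) →
    Reduces τ (lfp φ t) (setMoves (loc t) ∘ spread L)
  reduces-lfp {τ = τ} φ t L red {S} {T} u v pres h Y Y-closed = dne λ t∉Y →
    let replies = λ j → set-reply (env u j) (env v j) (loc t) (spread L j) (pres j)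
                          (j ≟ place τ t) (Y j)
                          (λ { refl → t∉Y ∘ subst (ext FT Y) (sym (fvalue≡point v t)) })
    in  proj₂ (proj₂ (replies (place τ t))) refl
          (subst (ext FS (proj₁ ∘ replies)) (fvalue≡point u t)
            (h (proj₁ ∘ replies)
               (λ (i , x) → X-closed (proj₁ ∘ replies) (λ j → proj₁ (proj₂ (replies j))) i x)))
    where
    FS = fusion (frame ∘ S) f
    FT = fusion (frame ∘ T) f

    Matched : FI S → ∀ j → D (frame (S j)) → D (frame (T j)) → Set
    Matched X j x y = All (Preserved (env u j ▸[ X j ] x) (env v j ▸[ Y j ] y)) (spread L j)

    Pair : FI S → Fin k → Set
    Pair X j = ∃₂ λ x y → Matched X j x y

    transfer : ∀ X i (ps : ∀ j → Pair X j) →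
               FSat (extendSet u X i (proj₁ ∘ ps)) φ → ext FT Y (i , proj₁ (proj₂ (ps i)))
    transfer X i ps hφ =
      let u′ = extendSet u X i (proj₁ ∘ ps)
          v′ = extendSet v Y i (λ j → proj₁ (proj₂ (ps j)))
      in  Y-closed _ (red i u′ v′ (unspread u′ v′ L (λ j → proj₂ (proj₂ (ps j))) i) hφ)

    -- A point outside `X` satisfying `φ` is answered in component `i` by a point outside `Y`. With
    -- default pairs in the other components `φ` transfers, and closure of `Y` is violated.
    X-closed : ∀ X → (∀ j → FreeMove.Reply (env u j) (env v j) (spread L j) (X j) (Y j)) → ∀ i x →
               sat FS _ _ ((i , x) ∷ᶠ felts u) (X ∷ᶠ fsets u) φ → ext FS X (i , x)
    X-closed X reply i x hφ = dne λ x∉X → refute x∉X (proj₁ (reply i) x x∉X)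
      where
      refute : ¬ ext FS X (i , x) →
        (∃ λ y → ¬ ext FT Y (i , y) × Matched X i x y) → ⊥
      refute x∉X (y , y∉Y , p) with override {P = Pair X} (proj₂ ∘ reply) i (x , y , p)
      ... | ps , e = y∉Y (subst (λ z → ext FT Y (i , z)) (cong (proj₁ ∘ proj₂) e)
              (transfer X i ps
                (subst (λ z → sat FS _ _ ((i , z) ∷ᶠ felts u) (X ∷ᶠ fsets u) φ)
                  (sym (cong proj₁ e)) hφ)))

  reduces-rel : ∀ {n s d} {π : Fin s → Bool} {τ : Fin n → Fin k} R ts →
    Reduces {d = d} {π} τ (rel R ts) (λ _ → qfTypes (vlookup ts) (f R))
  reduces-rel R ts u v pres =
    to (qf-transfer (vlookup ts) (f R) u v pres
      (λ x → trans (lookup-map x (fvalue u) ts) (fvalue≡point u (vlookup ts x)))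
      (λ x → trans (lookup-map x (fvalue v) ts) (fvalue≡point v (vlookup ts x))))

  reduces-eq : ∀ {n s d} {π : Fin s → Bool} {τ : Fin n → Fin k} t t′ →
    Reduces {d = d} {π} τ (eq t t′) (λ _ → eqᴸ (loc t) (loc t′) ∷ [])
  reduces-eq {d = d} {π} t t′ u v pres e =
    trans (fvalue≡point v t)
      (trans (point-eq {d = d} {π = π} u v _ _ (loc t) (loc t′) (All.head (pres _))
               (trans (sym (fvalue≡point u t)) (trans e (fvalue≡point u t′))))
             (sym (fvalue≡point v t′)))

  -- Within a component, a union of parameters is a finite disjunction of that component's own ones,
  -- so preserving each of these suffices.
  reduces-par : ∀ {n s d} {π : Fin s → Bool} {τ : Fin n → Fin k} Q t →
    Reduces {d = d} {π} τ (par Q t) (λ _ → tabulate (λ q → parᴸ q (loc t)))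
  reduces-par Q t {S} {T} u v pres h =
    let q , Qq , x = subst (unionPar (frame ∘ S) (λ j → prm (S j)) Q) (fvalue≡point u t) h
    in  subst (unionPar (frame ∘ T) (λ j → prm (T j)) Q) (sym (fvalue≡point v t))
          (q , Qq , tabulate⁻ (pres _) q x)

  memᴸ : ∀ {n s d} {π : Fin s → Bool} X {t : FTerm n} →
         (∀ Y → Pol (π Y) Y (mem {σ} {P = Fin k × Fin m' → Bool} X t)) → Loc π n d
  memᴸ {π = π} X {t} p = record
    { form = mem X (loc t) ; wf = mem X (loc t) ; depth = z≤n
    ; polar = λ Y → mem± (π Y) (p Y) (loc t) }

  reduces-mem : ∀ {n s d} {π : Fin s → Bool} {τ : Fin n → Fin k} X t p →
    Reduces {d = d} {π} τ (mem X t) (λ _ → memᴸ X {t} p ∷ [])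
  reduces-mem {τ = τ} X t p {S} {T} u v pres h =
    subst (ext (fusion (frame ∘ T) f) (fsets v X)) (sym (fvalue≡point v t))
      (subst (λ i → ext (frame (T j)) i (value (env v j) (loc t))) (sym (fsets-env v X j))
        (All.head (pres j)
          (subst (λ i → ext (frame (S j)) i (value (env u j) (loc t))) (fsets-env u X j)
            (subst (ext (fusion (frame ∘ S) f) (fsets u X)) (fvalue≡point u t) h))))
    where j = place τ t

  reduction : ∀ {n s} d {π : Fin s → Bool} (τ : Fin n → Fin k) (φ : FForm n s) → WF φ →
              qd φ ≤ d → (∀ X → Pol (π X) X φ) →
              Σ (Fin k → List (Loc π n d)) (Reduces τ φ)
  reduction d τ (rel R ts) w q p = _ , reduces-rel R ts
  reduction d τ (eq t t′)  w q p = _ , reduces-eq t t′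
  reduction d τ (par Q t)  w q p = _ , reduces-par Q t
  reduction d τ (mem X t)  w q p = _ , reduces-mem X t p
  reduction d {π} τ (neg φ) (neg w) q p =
    let L , red = reduction d {not ∘ π} τ φ w q (λ X → neg±⁻ (π X) (p X))
    in  map negᴸ ∘ L , λ u v pres h hφ →
          -- Preservation of the negated formulas from `u` to `v` is, by contraposition,
          -- preservation of the originals from `v` to `u`.
          h (red v u (λ j → All.map (λ r y → dne λ x → r x y) (map⁻ (pres j))) hφ)
  reduction d {π} τ (and φ ψ) (and w w′) q p =
    let L , red = reduction d {π} τ φ w (m⊔n≤o⇒m≤o _ _ q) (λ X → proj₁ (and±⁻ (π X) (p X)))
        K , der = reduction d {π} τ ψ w′ (m⊔n≤o⇒n≤o _ _ q) (λ X → proj₂ (and±⁻ (π X) (p X)))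
    in  (λ j → L j ++ K j) , λ u v pres (h , h′) →
          red u v (λ j → ++⁻ˡ (L j) (pres j)) h , der u v (λ j → ++⁻ʳ (L j) (pres j)) h′
  reduction d {π} τ (or φ ψ) (or w w′) q p =
    let L , red = reduction d {π} τ φ w (m⊔n≤o⇒m≤o _ _ q) (λ X → proj₁ (or±⁻ (π X) (p X)))
        K , der = reduction d {π} τ ψ w′ (m⊔n≤o⇒n≤o _ _ q) (λ X → proj₂ (or±⁻ (π X) (p X)))
    in  (λ j → L j ++ K j) , λ u v pres →
          [ inj₁ ∘ red u v (λ j → ++⁻ˡ (L j) (pres j)) ,
            inj₂ ∘ der u v (λ j → ++⁻ʳ (L j) (pres j)) ]
  reduction (suc d) {π} τ (ex φ) (ex w) (s≤s q) p =
    let r = λ i → reduction d {π} (i ∷ᶠ τ) φ w q (λ X → ex±⁻ (π X) (p X))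
    in  exMoves ∘ spread (proj₁ ∘ r) , reduces-ex φ (proj₁ ∘ r) (proj₂ ∘ r)
  reduction (suc d) {π} τ (all φ) (all w) (s≤s q) p =
    let r = λ i → reduction d {π} (i ∷ᶠ τ) φ w q (λ X → all±⁻ (π X) (p X))
    in  allMoves ∘ spread (proj₁ ∘ r) , reduces-all φ (proj₁ ∘ r) (proj₂ ∘ r)
  reduction (suc d) {π} τ (lfp φ t) (lfp _ w pos) (s≤s q) p =
    let r = λ i → reduction d {true ∷ᶠ π} (i ∷ᶠ τ) φ w q
                    -- The bound set variable gets sign `true` whatever the surrounding signs are,
                    -- by positivity of the body.
                    (λ { zero → pos ; (suc X) → lfp±⁻ (π X) (p X) })
    in  setMoves (loc t) ∘ spread (proj₁ ∘ r) , reduces-lfp φ t (proj₁ ∘ r) (proj₂ ∘ r)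

theorem5p32 : ExcludedMiddle 0ℓ →
    (σ : Sig) (k n m m' : ℕ) (f : (R : Sym σ) → QF σ k (ar σ R))
    (M N : Fin k → Frame σ) →
    ((j : Fin k) → IsHenkin (M j)) → ((j : Fin k) → IsHenkin (N j)) →
    1 ≤ m →
    (a : (j : Fin k) → Fin m → D (M j)) (b : (j : Fin k) → Fin m → D (N j))
    (A : (j : Fin k) → Fin m' → I (M j)) (B : (j : Fin k) → Fin m' → I (N j)) →
    ((j : Fin k) → Equiv n (M j) (a j) (λ q → ext (M j) (A j q))
    (N j) (b j) (λ q → ext (N j) (B j q))) →
    Equiv n (fusion M f) (fuseCon M a) (unionPar M A)
    (fusion N f) (fuseCon N b) (unionPar N B)
theorem5p32 em σ k n m m' f M N M-henkin N-henkin 1≤m a b A B equiv φ w q =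
  -- The local formulas are now sentences of depth at most `n`, so the hypothesis preserves them
  -- both ways, and one reduction serves both directions.
  mk⇔ (red u v (λ j → All.tabulate λ {ψ} _ → to (equiv j (form ψ) (wf ψ) (depth ψ))))
      (red v u (λ j → All.tabulate λ {ψ} _ → from (equiv j (form ψ) (wf ψ) (depth ψ))))
  where
  -- `1 ≤ m` is `0 < m`, so the anchor `c₀` is the first parameter.
  open Local em {σ} {m} {m'} (fromℕ< 1≤m)
  open Fusion em {σ} {k} {m} {m'} (fromℕ< 1≤m) f

  parts : (F : Fin k → Frame σ) → (∀ j → IsHenkin (F j)) →
          (∀ j → Fin m → D (F j)) → (∀ j → Fin m' → I (F j)) → Parts
  parts F henkin-F c p j = record
    { frame = F j ; henkin = henkin-F j ; cst = c j ; prm = p j }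

  u : FEnv (parts M M-henkin a A) (λ ()) 0
  u = record { env = λ j → (λ ()) ∣ (λ ()) ; felts = λ () ; fsets = λ ()
             ; felts-env = λ () ; fsets-env = λ () }

  v : FEnv (parts N N-henkin b B) (λ ()) 0
  v = record { env = λ j → (λ ()) ∣ (λ ()) ; felts = λ () ; fsets = λ ()
             ; felts-env = λ () ; fsets-env = λ () }

  red = proj₂ (reduction n {λ ()} (λ ()) φ w q (λ ()))
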